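{- All instances $(G,D,\Delta)$ of DiTTR with $\Delta=2$ are feasible.
   Context: All graphs are finite. A $\Delta$-periodic labeling of a directed graph $G=(V,E)$ is a map $\lambda:E\to\{0,1,\dots,\Delta-1\}$; edge $e$ is then active exactly at the times $\lambda(e)+i\Delta$, $i\in\mathbb{N}_0$. A temporal $s$-$z$-path is a sequence $(v_{i-1},v_i,t_i)_{i=1}^{\ell}$ with $v_0=s$, $v_\ell=z$, pairwise distinct vertices $v_0,\dots,v_\ell$, $(v_{i-1},v_i)\in E$ active at time $t_i$ for every $i$, and $t_1<t_2<\dots<t_\ell$ (strictly increasing). Its duration is $t_\ell+1-t_1$. A fastest temporal path is one of minimum duration. $\hat d(u,v)$ is the distance from $u$ to $v$ in the static graph $G$ (all edges have unit length). A bidirected tree is the directed graph obtained from an undirected tree by replacing each edge $\{u,v\}$ by the two directed edges $(u,v),(v,u)$ (which may get different labels). An instance of DiTTR is a triple $(G,D,\Delta)$ with $G=(V,E)$ a bidirected tree, $D$ a matrix indexed by $V\times V$ with entries positive integers or $\infty$ (no restriction) such that $D_{u,v}\ge \hat d(u,v)$ for all $u,v$, and $\Delta$ a positive integer. It is feasible (realizable) if there is a $\Delta$-periodic labeling $\lambda$ of $E$ such that, for all $u,v\in V$, the duration of a fastest temporal path from $u$ to $v$ is at most $D_{u,v}$. Diagonal entries of $D$ play no role; all conditions on $D$ are for distinct vertices. -}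

module Defs where

open import Data.Bool.Base using (Bool; T)
open import Data.Fin.Base using (Fin; toℕ)
open import Data.List.Base using (List; []; _∷_; foldl)
open import Data.List.Relation.Unary.Linked using (Linked)
open import Data.List.Relation.Unary.Unique.Propositional using (Unique)
open import Data.Nat.Base using (ℕ; zero; suc; _+_; _*_; _∸_; _≤_; _<_; NonZero)
open import Data.Product.Base using (Σ-syntax; ∃-syntax; _×_)
open import Level using (0ℓ)
open import Relation.Binary.Core using (Rel)
open import Relation.Binary.Construct.Add.Supremum.NonStrict _≤_ using (_≤⁺_)
open import Relation.Binary.Construct.Closure.ReflexiveTransitive using (Star; ε; _◅_)
open import Relation.Binary.PropositionalEquality.Core using (_≡_; _≢_)
open import Relation.Nullary.Construct.Add.Supremum using (_⁺; [_])
open import Relation.Nullary.Negation.Core using (¬_)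

-- `Star R u v` is the type of walks from u to v whose steps are taken from R.

module _ {V : Set} {R : Rel V 0ℓ} where

  length : ∀ {u v} → Star R u v → ℕ
  length ε       = zero
  length (_ ◅ w) = suc (length w)

  vertices : ∀ {u v} → Star R u v → List V
  vertices {u} ε       = u ∷ []
  vertices {u} (_ ◅ w) = u ∷ vertices w

record Path {V : Set} (R : Rel V 0ℓ) (u v : V) : Set where
  field
    walk     : Star R u v
    distinct : Unique (vertices walk)

-- Edge sets are Boolean-valued, so that the edges `T (edge u v)` from u to v
-- form a proposition and a labeling cannot depend on more than the edge.

record Digraph (n : ℕ) : Set where
  field
    edge : Fin n → Fin n → Bool

  Edge : Rel (Fin n) 0ℓ
  Edge u v = T (edge u v)

record Graph (n : ℕ) : Set where
  field
    adj : Fin n → Fin n → Bool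

  Adj : Rel (Fin n) 0ℓ
  Adj u v = T (adj u v)

  field
    symmetric   : ∀ {u v} → Adj u v → Adj v u
    irreflexive : ∀ {u} → ¬ Adj u u

module _ {n : ℕ} (G : Graph n) where
  open Graph G

  Connected : Set
  Connected = ∀ u v → Path Adj u v

  -- A cycle is a path with at least three vertices together with an edge
  -- joining its last vertex to its first.
  Acyclic : Set
  Acyclic = ∀ {u v} (p : Path Adj u v) → 2 ≤ length (Path.walk p) → ¬ Adj v u

  record IsTree : Set where
    field
      nonEmpty  : NonZero n
      connected : Connected
      acyclic   : Acyclic

bidirect : ∀ {n} → Graph n → Digraph n
bidirect G = record { edge = Graph.adj G }

IsDistance : ∀ {n} → Digraph n → Fin n → Fin n → ℕ → Set
IsDistance G u v d =
  (Σ[ p ∈ Path Edge u v ] length (Path.walk p) ≡ d)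
  × (∀ (p : Path Edge u v) → d ≤ length (Path.walk p))
  where open Digraph G

Labeling : ∀ {n} → Digraph n → ℕ → Set
Labeling {n} G Δ = ∀ (u v : Fin n) → Digraph.Edge G u v → Fin Δ

module _ {n : ℕ} {G : Digraph n} {Δ : ℕ} (lab : Labeling G Δ) where
  open Digraph G

  ActiveAt : ∀ {u v} → Edge u v → ℕ → Set
  ActiveAt {u} {v} e t = ∃[ i ] t ≡ toℕ (lab u v e) + i * Δ

  record TimedEdge (u v : Fin n) : Set where
    field
      edge   : Edge u v
      time   : ℕ
      active : ActiveAt edge time

  times : ∀ {u v} → Star TimedEdge u v → List ℕ
  times ε       = []
  times (e ◅ w) = TimedEdge.time e ∷ times w

  record TemporalPath (s z : Fin n) : Set where
    field
      path       : Path TimedEdge s z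
      increasing : Linked _<_ (times (Path.walk path))

-- t_ℓ + 1 - t_1 for the list t_1, …, t_ℓ.  The subtraction does not truncate on
-- increasing lists, and the empty list is not the list of times of a temporal
-- path between distinct vertices.
span : List ℕ → ℕ
span []       = 0
span (t ∷ ts) = (foldl (λ _ t′ → t′) t ts + 1) ∸ t

module _ {n : ℕ} {G : Digraph n} {Δ : ℕ} {lab : Labeling G Δ} {s z : Fin n} where

  duration : TemporalPath lab s z → ℕ
  duration p = span (times lab (Path.walk (TemporalPath.path p)))

  IsFastest : TemporalPath lab s z → Set
  IsFastest p = ∀ (q : TemporalPath lab s z) → duration p ≤ duration q

-- The type `ℕ ⁺` is ℕ with a top element, which plays the role of ∞.
record DiTTR : Set where
  field
    n         : ℕ
    tree      : Graph n
    isTree    : IsTree tree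
    D         : Fin n → Fin n → ℕ ⁺
    Δ         : ℕ
    Δ-nonZero : NonZero Δ

  G : Digraph n
  G = bidirect tree

  field
    D-positive : ∀ u v → u ≢ v → [ 1 ] ≤⁺ D u v
    D-distance : ∀ u v → u ≢ v → ∀ d → IsDistance G u v d → [ d ] ≤⁺ D u v

module _ (I : DiTTR) where
  open DiTTR I

  Realizes : Labeling G Δ → Set
  Realizes lab = ∀ u v → u ≢ v →
    Σ[ p ∈ TemporalPath lab u v ] IsFastest p × [ duration p ] ≤⁺ D u v

  Feasible : Set
  Feasible = Σ[ lab ∈ Labeling G Δ ] Realizes lab

{-# OPTIONS --safe #-}

-- A tree is bipartite; label every edge by the colour of its tail.  Along a path
-- the colours alternate, so with Δ = 2 one can traverse consecutive edges at
-- consecutive times, and the duration is the length of the path.  No temporal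
-- path is faster than that, because paths in a tree are unique.

module Submission where

open import Defs
open import Data.Fin.Base using (Fin; zero; suc; toℕ; opposite; fromℕ<)
open import Data.Fin.Properties using (opposite-involutive; _≟_)
open import Data.List.Base as List using (List; []; _∷_; foldl)
open import Data.List.Membership.Propositional using (_∈_)
open import Data.List.Relation.Unary.All as All using (All; []; _∷_)
open import Data.List.Relation.Unary.All.Properties using (¬Any⇒All¬)
open import Data.List.Relation.Unary.Any using (here; there; any?)
open import Data.List.Relation.Unary.AllPairs using ([]; _∷_)
open import Data.List.Relation.Unary.Linked using (Linked; []; [-]; _∷_)
open import Data.List.Relation.Unary.Unique.Propositional using (Unique)
open import Data.Nat.Base using (ℕ; zero; suc; _+_; _*_; _∸_; _≤_; _<_; z≤n; s≤s; >-nonZero⁻¹)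
open import Data.Nat.Properties
  using (suc-injective; +-suc; +-comm; +-monoʳ-≤; ∸-monoˡ-≤; m+n∸n≡m; n<1+n; ≤-refl; ≤-reflexive; module ≤-Reasoning)
open import Data.Product.Base using (Σ-syntax; ∃-syntax; _×_; _,_; proj₁)
open import Data.Sum.Base using (_⊎_; inj₁; inj₂)
open import Level using (0ℓ)
open import Relation.Binary.Core using (Rel; _⇒_)
open import Relation.Binary.Construct.Add.Supremum.NonStrict _≤_ using (_≤⁺_)
open import Relation.Binary.Construct.Closure.ReflexiveTransitive using (Star; ε; _◅_; _◅◅_; map)
open import Relation.Binary.PropositionalEquality
  using (_≡_; refl; sym; trans; cong; subst; module ≡-Reasoning)
open import Relation.Nullary using (yes; no; contradiction)
open import Relation.Nullary.Construct.Add.Supremum using ([_])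

module _ {V : Set} {R : Rel V 0ℓ} where

  length-vertices : ∀ {u v} (w : Star R u v) → List.length (vertices w) ≡ suc (length w)
  length-vertices ε       = refl
  length-vertices (_ ◅ w) = cong suc (length-vertices w)

  source∈vertices : ∀ {u v} (w : Star R u v) → u ∈ vertices w
  source∈vertices ε       = here refl
  source∈vertices (_ ◅ _) = here refl

  target∈vertices : ∀ {u v} (w : Star R u v) → v ∈ vertices w
  target∈vertices ε       = here refl
  target∈vertices (_ ◅ w) = there (target∈vertices w)

  All-vertices-◅◅⁻ˡ : ∀ {P : V → Set} {u x v} (a : Star R u x) (b : Star R x v) →
                      All P (vertices (a ◅◅ b)) → All P (vertices a)
  All-vertices-◅◅⁻ˡ ε       b ps       = All.lookup ps (source∈vertices b) ∷ []
  All-vertices-◅◅⁻ˡ (_ ◅ a) b (p ∷ ps) = p ∷ All-vertices-◅◅⁻ˡ a b ps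

  Unique-vertices-◅◅⁻ : ∀ {u x v} (a : Star R u x) (b : Star R x v) →
                        Unique (vertices (a ◅◅ b)) → Unique (vertices a) × Unique (vertices b)
  Unique-vertices-◅◅⁻ ε       b ps       = [] ∷ [] , ps
  Unique-vertices-◅◅⁻ (_ ◅ a) b (p ∷ ps) with Unique-vertices-◅◅⁻ a b ps
  ... | pa , pb = All-vertices-◅◅⁻ˡ a b p ∷ pa , pb

  ∈-vertices-split : ∀ {u v x} (w : Star R u v) → x ∈ vertices w →
                     Σ[ a ∈ Star R u x ] Σ[ b ∈ Star R x v ] w ≡ a ◅◅ b
  ∈-vertices-split ε       (here refl) = ε , ε , refl
  ∈-vertices-split (e ◅ w) (here refl) = ε , e ◅ w , refl
  ∈-vertices-split (e ◅ w) (there x∈w) with ∈-vertices-split w x∈w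
  ... | a , b , refl = e ◅ a , b , refl

  length-cong : ∀ {u v u′ v′} (w : Star R u v) (w′ : Star R u′ v′) →
                vertices w ≡ vertices w′ → length w ≡ length w′
  length-cong w w′ eq = suc-injective
    (trans (sym (length-vertices w)) (trans (cong List.length eq) (length-vertices w′)))

  length-cong-∷ : ∀ {u v u′ v′ x} (w : Star R u v) (w′ : Star R u′ v′) →
                  vertices w ≡ x ∷ vertices w′ → length w ≡ suc (length w′)
  length-cong-∷ w w′ eq = suc-injective
    (trans (sym (length-vertices w)) (trans (cong List.length eq) (cong suc (length-vertices w′))))

module _ {V : Set} {R S : Rel V 0ℓ} (f : R ⇒ S) where

  vertices-map : ∀ {u v} (w : Star R u v) → vertices (map {U = S} f w) ≡ vertices w
  vertices-map ε       = refl
  vertices-map (_ ◅ w) = cong (_ ∷_) (vertices-map w)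

  length-map : ∀ {u v} (w : Star R u v) → length (map {U = S} f w) ≡ length w
  length-map ε       = refl
  length-map (_ ◅ w) = cong suc (length-map w)

  mapPath : ∀ {u v} → Path R u v → Path S u v
  mapPath p = record
    { walk     = map f (Path.walk p)
    ; distinct = subst Unique (sym (vertices-map (Path.walk p))) (Path.distinct p)
    }

module _ {n : ℕ} (T : Graph n) (acyclic : Acyclic T) where
  open Graph T

  -- If x already lies on p, acyclicity forces it to be the second vertex of p.
  prependEdge : ∀ {x u v} → Adj x u → (p : Path Adj u v) → Σ[ q ∈ Path Adj x v ]
                (vertices (Path.walk q) ≡ x ∷ vertices (Path.walk p) ⊎
                 vertices (Path.walk p) ≡ u ∷ vertices (Path.walk q))
  prependEdge {x} e record { walk = w ; distinct = d } with any? (x ≟_) (vertices w)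
  ... | no x∉w = record { walk = e ◅ w ; distinct = ¬Any⇒All¬ _ x∉w ∷ d } , inj₁ refl
  ... | yes x∈w with ∈-vertices-split w x∈w
  ...   | ε , b , refl = contradiction e irreflexive
  ...   | _ ◅ ε , b , refl with d
  ...     | _ ∷ d′ = record { walk = b ; distinct = d′ } , inj₂ refl
  prependEdge e record { walk = w ; distinct = d } | yes _ | a@(_ ◅ _ ◅ _) , b , refl =
    contradiction e
      (acyclic record { walk = a ; distinct = proj₁ (Unique-vertices-◅◅⁻ a b d) } (s≤s (s≤s z≤n)))

  path-unique : ∀ {u v} (p q : Path Adj u v) → vertices (Path.walk p) ≡ vertices (Path.walk q)
  path-unique record { walk = w ; distinct = d } = go w d
    where
    go : ∀ {u v} (w : Star Adj u v) → Unique (vertices w) → (q : Path Adj u v) →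
         vertices w ≡ vertices (Path.walk q)
    go ε       _        record { walk = ε } = refl
    go ε       _        record { walk = _ ◅ w ; distinct = u∉w ∷ _ } =
      contradiction refl (All.lookup u∉w (target∈vertices w))
    go (e ◅ w) (u∉w ∷ d) q with prependEdge (symmetric e) q
    ... | q′ , inj₁ eq = contradiction refl (All.lookup u∉w
            (subst (_ ∈_) (sym (trans (go w d q′) eq)) (there (source∈vertices (Path.walk q)))))
    ... | q′ , inj₂ eq = trans (cong (_ ∷_) (go w d q′)) (sym eq)

  path-length-unique : ∀ {u v} (p q : Path Adj u v) → length (Path.walk p) ≡ length (Path.walk q)
  path-length-unique p q = length-cong (Path.walk p) (Path.walk q) (path-unique p q)

parityColour : ℕ → Fin 2
parityColour zero    = zero
parityColour (suc k) = opposite (parityColour k)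

Proper : ∀ {n} → Graph n → (Fin n → Fin 2) → Set
Proper T c = ∀ {u v} → Graph.Adj T u v → c v ≡ opposite (c u)

tree-bipartite : ∀ {n} (T : Graph n) → IsTree T → ∃[ c ] Proper T c
tree-bipartite {n} T isTree = (λ u → parityColour (depth u)) , proper
  where
  open Graph T
  open IsTree isTree

  toRoot : ∀ u → Path Adj u (fromℕ< (>-nonZero⁻¹ n {{nonEmpty}}))
  toRoot u = connected u _

  depth : Fin n → ℕ
  depth u = length (Path.walk (toRoot u))

  proper : Proper T (λ u → parityColour (depth u))
  proper {u} {v} e with prependEdge T acyclic e (toRoot v)
  ... | q , eq rewrite path-length-unique T acyclic (toRoot u) q with eq
  ...   | inj₁ q≡u∷v = trans (sym (opposite-involutive _))
            (cong (λ k → opposite (parityColour k)) (sym (length-cong-∷ (Path.walk q) (Path.walk (toRoot v)) q≡u∷v)))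
  ...   | inj₂ v≡v∷q = cong parityColour (length-cong-∷ (Path.walk (toRoot v)) (Path.walk q) v≡v∷q)

last-time : ℕ → List ℕ → ℕ
last-time = foldl (λ _ t → t)

length≤last-time : ∀ t ts → Linked _<_ (t ∷ ts) → List.length ts + t ≤ last-time t ts
length≤last-time t []        _          = ≤-refl
length≤last-time t (t′ ∷ ts) (t<t′ ∷ l) = begin
  suc (List.length ts + t)  ≡⟨ +-suc (List.length ts) t ⟨
  List.length ts + suc t    ≤⟨ +-monoʳ-≤ (List.length ts) t<t′ ⟩
  List.length ts + t′       ≤⟨ length≤last-time t′ ts l ⟩
  last-time t′ ts           ∎
  where open ≤-Reasoning

length≤span : ∀ {ts} → Linked _<_ ts → List.length ts ≤ span ts
length≤span {[]}     _ = z≤n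
length≤span {t ∷ ts} l = begin
  suc (List.length ts)            ≡⟨ m+n∸n≡m (suc (List.length ts)) t ⟨
  suc (List.length ts + t) ∸ t    ≤⟨ ∸-monoˡ-≤ t (s≤s (length≤last-time t ts l)) ⟩
  suc (last-time t ts) ∸ t        ≡⟨ cong (_∸ t) (+-comm 1 (last-time t ts)) ⟩
  last-time t ts + 1 ∸ t          ∎
  where open ≤-Reasoning

module _ {n : ℕ} {G : Digraph n} {Δ : ℕ} (lab : Labeling G Δ) where

  length-times : ∀ {u v} (w : Star (TimedEdge lab) u v) → List.length (times lab w) ≡ length w
  length-times ε       = refl
  length-times (_ ◅ w) = cong suc (length-times w)

  forgetTimes : ∀ {u v} → TemporalPath lab u v → Path (Digraph.Edge G) u v
  forgetTimes q = mapPath TimedEdge.edge (TemporalPath.path q)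

  length≤duration : ∀ {u v} (q : TemporalPath lab u v) →
                    length (Path.walk (forgetTimes q)) ≤ duration q
  length≤duration q = begin
    length (map TimedEdge.edge w)  ≡⟨ length-map TimedEdge.edge w ⟩
    length w                       ≡⟨ length-times w ⟨
    List.length (times lab w)      ≤⟨ length≤span (TemporalPath.increasing q) ⟩
    duration q                     ∎
    where
    open ≤-Reasoning
    w = Path.walk (TemporalPath.path q)

module _ {n : ℕ} (T : Graph n) (c : Fin n → Fin 2) (proper : Proper T c) where
  open Graph T

  tailLabeling : Labeling (bidirect T) 2
  tailLabeling u _ _ = c u

  Active : Fin n → ℕ → Set
  Active u t = ∃[ i ] t ≡ toℕ (c u) + i * 2

  active-suc : ∀ {u v t} → Adj u v → Active u t → Active v (suc t)
  active-suc {u} {v} e (i , refl) rewrite proper e with c u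
  ... | zero     = i , refl
  ... | suc zero = suc i , refl

  schedule : ∀ {u v t} → Active u t → Star Adj u v → Star (TimedEdge tailLabeling) u v
  schedule a ε       = ε
  schedule a (e ◅ w) = record { edge = e ; active = a } ◅ schedule (active-suc e a) w

  vertices-schedule : ∀ {u v t} (a : Active u t) (w : Star Adj u v) →
                      vertices (schedule a w) ≡ vertices w
  vertices-schedule a ε       = refl
  vertices-schedule a (e ◅ w) = cong (_ ∷_) (vertices-schedule (active-suc e a) w)

  times-schedule-increasing : ∀ {u v t} (a : Active u t) (w : Star Adj u v) →
                              Linked _<_ (times tailLabeling (schedule a w))
  times-schedule-increasing a ε               = []
  times-schedule-increasing a (_ ◅ ε)         = [-]
  times-schedule-increasing a (e ◅ w@(_ ◅ _)) = n<1+n _ ∷ times-schedule-increasing (active-suc e a) w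

  last-time-schedule : ∀ {u v t} (a : Active u (suc t)) (w : Star Adj u v) →
                       last-time t (times tailLabeling (schedule a w)) ≡ length w + t
  last-time-schedule         a ε       = refl
  last-time-schedule {t = t} a (e ◅ w) =
    trans (last-time-schedule (active-suc e a) w) (+-suc (length w) t)

  span-schedule : ∀ {u v t} (a : Active u t) (w : Star Adj u v) →
                  span (times tailLabeling (schedule a w)) ≡ length w
  span-schedule         a ε       = refl
  span-schedule {t = t} a (e ◅ w) = begin
    last-time t (times tailLabeling (schedule (active-suc e a) w)) + 1 ∸ t
      ≡⟨ cong (λ l → l + 1 ∸ t) (last-time-schedule (active-suc e a) w) ⟩
    length w + t + 1 ∸ t
      ≡⟨ cong (_∸ t) (+-comm (length w + t) 1) ⟩
    suc (length w) + t ∸ t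
      ≡⟨ m+n∸n≡m (suc (length w)) t ⟩
    suc (length w)
      ∎
    where open ≡-Reasoning

  scheduledPath : ∀ {u v} → Path Adj u v → TemporalPath tailLabeling u v
  scheduledPath p = record
    { path = record
      { walk     = schedule (0 , refl) (Path.walk p)
      ; distinct = subst Unique (sym (vertices-schedule (0 , refl) (Path.walk p))) (Path.distinct p)
      }
    ; increasing = times-schedule-increasing (0 , refl) (Path.walk p)
    }

  duration-scheduledPath : ∀ {u v} (p : Path Adj u v) → duration (scheduledPath p) ≡ length (Path.walk p)
  duration-scheduledPath p = span-schedule (0 , refl) (Path.walk p)

  scheduledPath-fastest : Acyclic T → ∀ {u v} (p : Path Adj u v) → IsFastest (scheduledPath p)
  scheduledPath-fastest acyclic p q = begin
    duration (scheduledPath p)                            ≡⟨ duration-scheduledPath p ⟩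
    length (Path.walk p)                                  ≡⟨ path-length-unique T acyclic p (forgetTimes tailLabeling q) ⟩
    length (Path.walk (forgetTimes tailLabeling q))       ≤⟨ length≤duration tailLabeling q ⟩
    duration q                                            ∎
    where open ≤-Reasoning

corollary8 : (I : DiTTR) → DiTTR.Δ I ≡ 2 → Feasible I
corollary8 record { tree = T ; isTree = isTree ; D = D ; D-distance = D-distance } refl
  with tree-bipartite T isTree
... | c , proper = tailLabeling T c proper , λ u v u≢v →
  let p = connected u v in
  scheduledPath T c proper p ,
  scheduledPath-fastest T c proper acyclic p ,
  subst (λ d → [ d ] ≤⁺ D u v) (sym (duration-scheduledPath T c proper p))
    (D-distance u v u≢v _ ((p , refl) , λ q → ≤-reflexive (path-length-unique T acyclic p q)))
  where open IsTree isTree
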